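{- For any prime power $k$, we have $$b_k(2) \geq k^2 +1.$$
   Context: For a positive integer $k$, $b_k(2)$ denotes the diagonal multicolor bipartite Ramsey number for the quadrilateral: the least positive integer $b$ such that any coloring of the edges of the complete bipartite graph $K_{b,b}$ with $k$ colors contains a monochromatic copy of $K_{2,2}=C_4$ (a 4-cycle all of whose edges have the same color). A prime power is a number $p^a$ with $p$ prime and $a\ge 1$. -}

module Defs where

open import Data.Fin as Fin using (Fin; inject≤; combine; finToFun; funToFin)
open import Data.Fin.Properties using (_≟_; any?; all?; pigeonhole; combine-injective; inject≤-injective; finToFun-funToFin; <⇒≢)
open import Data.Nat using (ℕ; suc; _*_; _^_; _≤_; _<_; z≤n; s≤s; _≤?_)
open import Data.Nat.Induction using (<-rec)
open import Data.Nat.Primality using (Prime)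
open import Data.Nat.Properties using (≤-refl; m≤m*n; ≮⇒≥; anyUpTo?)
open import Data.Product using (∃; ∃₂; _×_; _,_; proj₁; proj₂)
open import Relation.Binary.PropositionalEquality using (_≡_; _≢_; refl; sym; trans; cong)
open import Relation.Nullary using (Dec; yes; no)
open import Relation.Nullary.Decidable using (map′; _×-dec_; ¬?)

PrimePower : ℕ → Set
PrimePower k = ∃₂ λ p a → Prime p × 1 ≤ a × k ≡ p ^ a

-- The edges of K_{b,b} are the pairs (x , y) of a left vertex x and a right
-- vertex y; not every colour has to be used.
Colouring : ℕ → ℕ → Set
Colouring k b = Fin b → Fin b → Fin k

-- Every 4-cycle of K_{b,b} has two vertices x, x′ on the left and two
-- vertices y, y′ on the right.
HasMonochromaticC₄ : ∀ {k b} → Colouring k b → Set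
HasMonochromaticC₄ {k} {b} c =
  ∃ λ (i : Fin k) → ∃₂ λ (x x′ : Fin b) → ∃₂ λ (y y′ : Fin b) →
    x ≢ x′ × y ≢ y′ ×
    c x y ≡ i × c x y′ ≡ i × c x′ y ≡ i × c x′ y′ ≡ i

EveryColouringHasC₄ : ℕ → ℕ → Set
EveryColouringHasC₄ k b = (c : Colouring k b) → HasMonochromaticC₄ c

record IsBipartiteRamseyNumber (k b : ℕ) : Set where
  field
    positive : 1 ≤ b
    arrows   : EveryColouringHasC₄ k b
    minimal  : ∀ {b′} → 1 ≤ b′ → EveryColouringHasC₄ k b′ → b ≤ b′

hasMonochromaticC₄? : ∀ {k b} (c : Colouring k b) → Dec (HasMonochromaticC₄ c)
hasMonochromaticC₄? c =
  any? λ i → any? λ x → any? λ x′ → any? λ y → any? λ y′ →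
    ¬? (x ≟ x′) ×-dec ¬? (y ≟ y′) ×-dec
    (c x y ≟ i) ×-dec (c x y′ ≟ i) ×-dec (c x′ y ≟ i) ×-dec (c x′ y′ ≟ i)

-- Colourings are enumerated by Fin ((k ^ b) ^ b), up to pointwise equality.
everyColouringHasC₄? : ∀ k b → Dec (EveryColouringHasC₄ k b)
everyColouringHasC₄? k b =
  map′ to (λ h n → h (decode n)) (all? λ n → hasMonochromaticC₄? (decode n))
  where
  decode : Fin ((k ^ b) ^ b) → Colouring k b
  decode n x = finToFun (finToFun n x)

  encode : Colouring k b → Fin ((k ^ b) ^ b)
  encode c = funToFin λ x → funToFin (c x)

  decode-encode : ∀ c x y → c x y ≡ decode (encode c) x y
  decode-encode c x y = sym (trans
    (cong (λ r → finToFun {k} {b} r y) (finToFun-funToFin (λ z → funToFin (c z)) x))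
    (finToFun-funToFin (c x) y))

  to : (∀ n → HasMonochromaticC₄ (decode n)) → EveryColouringHasC₄ k b
  to h c with h (encode c)
  ... | i , x , x′ , y , y′ , x≢x′ , y≢y′ , p , q , r , s =
    i , x , x′ , y , y′ , x≢x′ , y≢y′ ,
    trans (decode-encode c x y) p , trans (decode-encode c x y′) q ,
    trans (decode-encode c x′ y) r , trans (decode-encode c x′ y′) s

upperBound : ℕ → ℕ
upperBound k = suc (k * (suc k * suc k))

-- Among the first k + 1 left vertices, each right vertex y sees two joined to
-- it by edges of one colour; two right vertices agree on that pair and colour.
upperBound-arrows : ∀ k → EveryColouringHasC₄ k (upperBound k)
upperBound-arrows k c =
  let y , y′ , y<y′ , code≡ = pigeonhole ≤-refl code
      u , v , u<v , cuy≡cvy = twins y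
      u′ , v′ , _ , cu′y′≡cv′y′ = twins y′
      same , uv≡ = combine-injective (c (left u) y) (combine u v)
                                     (c (left u′) y′) (combine u′ v′) code≡
      u≡u′ , v≡v′ = combine-injective u v u′ v′ uv≡
  in c (left u) y , left u , left v , y , y′ ,
     (λ lu≡lv → <⇒≢ u<v (inject≤-injective _ _ u v lu≡lv)) , <⇒≢ y<y′ ,
     refl ,
     trans (cong (λ w → c (left w) y′) u≡u′) (sym same) ,
     sym cuy≡cvy ,
     trans (cong (λ w → c (left w) y′) v≡v′) (trans (sym cu′y′≡cv′y′) (sym same))
  where
  left : Fin (suc k) → Fin (upperBound k)
  left u = inject≤ u (s≤s (m≤m*n k (suc k * suc k)))

  twins : ∀ y → ∃₂ λ u v → u Fin.< v × c (left u) y ≡ c (left v) y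
  twins y = pigeonhole ≤-refl (λ u → c (left u) y)

  code : Fin (upperBound k) → Fin (k * (suc k * suc k))
  code y = let u , v , _ = twins y in combine (c (left u) y) (combine u v)

module _ {P : ℕ → Set} (P? : ∀ n → Dec (P n)) where

  LeastPositive : ℕ → Set
  LeastPositive m = 1 ≤ m × P m × (∀ {l} → 1 ≤ l → P l → m ≤ l)

  leastPositive : ∀ {n} → 1 ≤ n → P n → ∃ LeastPositive
  leastPositive {n} = <-rec (λ n → 1 ≤ n → P n → ∃ LeastPositive) step n
    where
    step : ∀ n → (∀ {m} → m < n → 1 ≤ m → P m → ∃ LeastPositive) →
           1 ≤ n → P n → ∃ LeastPositive
    step n rec 1≤n Pn with anyUpTo? (λ m → (1 ≤? m) ×-dec P? m) n
    ... | yes (m , m<n , 1≤m , Pm) = rec m<n 1≤m Pm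
    ... | no  none = n , 1≤n , Pn ,
      λ 1≤l Pl → ≮⇒≥ λ l<n → none (_ , l<n , 1≤l , Pl)

bipartiteRamseyNumber : ∀ k → ∃ (IsBipartiteRamseyNumber k)
bipartiteRamseyNumber k
  with b , 1≤b , arrows , minimal
    ← leastPositive (everyColouringHasC₄? k) (s≤s z≤n) (upperBound-arrows k)
  = b , record { positive = 1≤b ; arrows = arrows ; minimal = minimal }

-- b₂ k is the number written b_k(2).
b₂ : ℕ → ℕ
b₂ k = proj₁ (bipartiteRamseyNumber k)

b₂-isBipartiteRamseyNumber : ∀ k → IsBipartiteRamseyNumber k (b₂ k)
b₂-isBipartiteRamseyNumber k = proj₂ (bipartiteRamseyNumber k)

{-# OPTIONS --safe #-}

-- Colour the pair formed by a point (x , y) and a line (m , b) over the field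
-- with q elements by y + b + m x.  A monochromatic 4-cycle gives
-- (m − m′)(x − x′) = 0, and then two of its vertices coincide.
--
-- The field with q = p ^ a elements is obtained from the polynomials over ℤ/p
-- acting on sequences, X being the shift, modulo the annihilator of a sequence
-- w of period n = q − 1.  There X ^ q = X, hence f ^ q = f for every f, so that
-- f divides 1 modulo the annihilator of f ▷ w.  Starting from the impulses at
-- the multiples of n, pass to ∏ (X ^ (p ^ t − 1) − 1) ▷ w over 1 ≤ t < a, which
-- is non-zero for reasons of degree, and then to f ▷ w for all f in turn, as
-- long as the result is non-zero; what remains is a field.  With d its
-- dimension over ℤ/p, the a distinct conjugates X ^ (p ^ i) are roots of the
-- minimal polynomial of X, so a ≤ d, and all p ^ d elements are roots of
-- T ^ q − T, so d ≤ a.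
module Submission where

open import Algebra.Bundles using (CommutativeRing)
import Algebra.Properties.Semiring.Mult as Multiples
open import Data.Fin using (Fin; zero; suc; toℕ; fromℕ; inject₁; fromℕ<; inject≤; combine; remQuot; finToFun)
import Data.Fin.Properties as Fin
open import Data.Integer as ℤ using (ℤ; +_)
import Data.Integer.Divisibility.Signed as ℤ
open import Data.Integer.DivMod using (_%ℕ_; _/ℕ_; n%ℕd<d; a≡a%ℕn+[a/ℕn]*n)
import Data.Integer.Properties as ℤ
import Data.Integer.Tactic.RingSolver as ℤ
open import Data.List using ([]; _∷_; map; allFin)
open import Data.List.Membership.Propositional.Properties using (∈-map⁺; ∈-allFin)
open import Data.List.Relation.Unary.All as All using (All; []; _∷_)
open import Data.Nat as ℕ using (ℕ; zero; suc; _≤_; _<_; z≤n; s≤s; NonZero)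
open import Data.Nat.Combinatorics using (_C_; nC1≡n; nCn≡1; nCk+nC[k+1]≡[n+1]C[k+1]; k>n⇒nCk≡0)
open import Data.Nat.Coprimality using (prime⇒coprime; coprime-Bézout)
open import Data.Nat.Divisibility as ℕ using (_∣_; divides; ∣⇒≤)
open import Data.Nat.DivMod using (m≡m%n+[m/n]*n; m%n<n)
open import Data.Nat.GCD using (module Bézout)
open import Data.Nat.Primality using (Prime; euclidsLemma; prime⇒nonZero; prime⇒nonTrivial)
import Data.Nat.Properties as ℕ
import Data.Nat.Tactic.RingSolver as ℕ
open import Data.Product using (∃; _×_; _,_; proj₁; proj₂; uncurry)
open import Data.Sum using (_⊎_; inj₁; inj₂; [_,_]′)
open import Defs
open import Function using (_∘_; Injective)
open import Level using (_⊔_; 0ℓ)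
open import Relation.Binary.Definitions using (tri<; tri≈; tri>)
open import Relation.Binary.PropositionalEquality as ≡ using (_≡_; cong; cong₂; subst)
open import Relation.Nullary using (¬_; Dec; yes; no; contradiction)
open import Relation.Nullary.Decidable using (map′)

-- Monic polynomial functions and the bound on the number of their roots.

module MonicPolynomials {c ℓ} (R : CommutativeRing c ℓ) where

  open CommutativeRing R hiding (zero)
  open import Algebra.Properties.CommutativeSemiring.Exp commutativeSemiring
  open import Algebra.Solver.Ring.NaturalCoefficients.Default commutativeSemiring
  open import Relation.Binary.Reasoning.Setoid setoid

  -- Polynomials are functions with a Horner certificate, so factors and roots are handled
  -- pointwise; the innermost `one` is the leading coefficient.
  data Monic : ℕ → (Carrier → Carrier) → Set (c ⊔ ℓ) where
    one    : ∀ {f} → (∀ x → f x ≈ 1#) → Monic 0 f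
    horner : ∀ {m f g} a → Monic m g → (∀ x → f x ≈ x * g x + a) → Monic (suc m) f

  monic-resp : ∀ {m f g} → (∀ x → f x ≈ g x) → Monic m f → Monic m g
  monic-resp f≈g (one e)        = one λ x → trans (sym (f≈g x)) (e x)
  monic-resp f≈g (horner a G e) = horner a G λ x → trans (sym (f≈g x)) (e x)

  monic-power : ∀ m → Monic m (_^ m)
  monic-power zero    = one λ _ → refl
  monic-power (suc m) = horner 0# (monic-power m) λ x → sym (+-identityʳ _)

  monic-addTerm : ∀ {m f} → Monic m f → ∀ {k} → k < m → ∀ b →
                  Monic m (λ x → f x + b * x ^ k)
  monic-addTerm (horner a G eq) {zero} _ b = horner (a + b) G λ x →
    trans (+-cong (eq x) (*-identityʳ b)) (+-assoc _ a b)
  monic-addTerm (horner {f = f} {g} a G eq) {suc k} (s≤s k<m) b =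
    horner a (monic-addTerm G k<m b) λ x → begin
      f x + b * (x * x ^ k)             ≈⟨ +-congʳ (eq x) ⟩
      x * g x + a + b * (x * x ^ k)     ≈⟨ solve 5 (λ x g a b y → x :* g :+ a :+ b :* (x :* y) := x :* (g :+ b :* y) :+ a) refl x (g x) a b (x ^ k) ⟩
      x * (g x + b * x ^ k) + a         ∎

  -- f(x) − f(r) = (x − r) g(x), with the subtractions moved across.
  monic-factor : ∀ {m f} → Monic (suc m) f → ∀ r →
                 ∃ λ g → Monic m g × ∀ x → f x + r * g x ≈ x * g x + f r
  monic-factor (horner {f = f} {g} a G@(one g≈1) eq) r = g , G , λ x → begin
    f x + r * g x            ≈⟨ +-cong (eq x) (*-congˡ (trans (g≈1 x) (sym (g≈1 r)))) ⟩
    x * g x + a + r * g r    ≈⟨ +-assoc _ _ _ ⟩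
    x * g x + (a + r * g r)  ≈⟨ +-congˡ (trans (+-comm _ _) (sym (eq r))) ⟩
    x * g x + f r            ∎
  monic-factor (horner {f = f} {g} a G@(horner _ _ _) eq) r
    with h , H , g-factor ← monic-factor G r =
    (λ x → x * h x + g r) , horner (g r) H (λ _ → refl) , λ x → begin
      f x + r * (x * h x + g r)              ≈⟨ +-congʳ (eq x) ⟩
      x * g x + a + r * (x * h x + g r)      ≈⟨ solve 6 (λ x g a r h s → x :* g :+ a :+ r :* (x :* h :+ s) := x :* (g :+ r :* h) :+ (r :* s :+ a)) refl x (g x) a r (h x) (g r) ⟩
      x * (g x + r * h x) + (r * g r + a)    ≈⟨ +-cong (*-congˡ (g-factor x)) (sym (eq r)) ⟩
      x * (x * h x + g r) + f r              ∎

  module _ (1≉0 : ¬ 1# ≈ 0#) (cancel : ∀ x y z → x * z ≈ y * z → x ≈ y ⊎ z ≈ 0#) where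

    -- Split off the first root r: at any other root x the factorisation reads r g(x) = x g(x), and
    -- since x differs from r, `cancel` leaves g(x) = 0.
    roots-≤-degree : ∀ {m l f} → Monic m f → (root : Fin l → Carrier) →
                     Injective _≡_ _≈_ root → (∀ i → f (root i) ≈ 0#) → l ≤ m
    roots-≤-degree {l = zero} _ _ _ _ = z≤n
    roots-≤-degree {zero} {suc l} (one f≈1) root _ f≈0 =
      contradiction (trans (sym (f≈1 _)) (f≈0 zero)) 1≉0
    roots-≤-degree {suc m} {suc l} {f} F root inj f≈0
      with g , G , f-factor ← monic-factor F (root zero) =
      s≤s (roots-≤-degree G (root ∘ suc) (Fin.suc-injective ∘ inj) g≈0)
      where
      g≈0 : ∀ i → g (root (suc i)) ≈ 0#
      g≈0 i with cancel (root zero) x (g x) r*g≈x*g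
        where
        x = root (suc i)
        r*g≈x*g : root zero * g x ≈ x * g x
        r*g≈x*g = begin
          root zero * g x        ≈⟨ +-identityˡ _ ⟨
          0# + root zero * g x   ≈⟨ +-congʳ (f≈0 (suc i)) ⟨
          f x + root zero * g x  ≈⟨ f-factor x ⟩
          x * g x + f (root zero) ≈⟨ +-congˡ (f≈0 zero) ⟩
          x * g x + 0#           ≈⟨ +-identityʳ _ ⟩
          x * g x                ∎
      ... | inj₁ r≈x = contradiction (inj r≈x) λ ()
      ... | inj₂ gx≈0 = gx≈0

-- Binomial coefficients modulo a prime, and the Frobenius map.

binomial-absorption : ∀ n k → suc k ℕ.* (suc n C suc k) ≡ suc n ℕ.* (n C k)
binomial-absorption zero zero = ≡.refl
binomial-absorption zero (suc k) = begin
  suc (suc k) ℕ.* (1 C suc (suc k)) ≡⟨ cong (suc (suc k) ℕ.*_) (k>n⇒nCk≡0 (s≤s (s≤s (z≤n {k})))) ⟩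
  suc (suc k) ℕ.* 0                 ≡⟨ ℕ.*-zeroʳ (suc (suc k)) ⟩
  0                                 ≡⟨ cong (ℕ._+ 0) (k>n⇒nCk≡0 (s≤s (z≤n {k}))) ⟨
  (0 C suc k) ℕ.+ 0                 ∎
  where open ≡.≡-Reasoning
binomial-absorption (suc n) zero = begin
  (suc (suc n) C 1) ℕ.+ 0  ≡⟨ ℕ.+-identityʳ _ ⟩
  suc (suc n) C 1          ≡⟨ nC1≡n (suc (suc n)) ⟩
  suc (suc n)              ≡⟨ ℕ.*-identityʳ _ ⟨
  suc (suc n) ℕ.* 1        ∎
  where open ≡.≡-Reasoning
binomial-absorption (suc n) (suc k) = begin
  suc (suc k) ℕ.* (suc (suc n) C suc (suc k))
    ≡⟨ cong (suc (suc k) ℕ.*_) (nCk+nC[k+1]≡[n+1]C[k+1] (suc n) (suc k)) ⟨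
  suc (suc k) ℕ.* (a ℕ.+ b)
    -- The copy of `a` set apart here raises the factor `suc n`, which both induction hypotheses
    -- supply, to `suc (suc n)`.
    ≡⟨ regroup k a b ⟩
  a ℕ.+ (suc k ℕ.* a ℕ.+ suc (suc k) ℕ.* b)
    ≡⟨ cong (a ℕ.+_) (cong₂ ℕ._+_ (binomial-absorption n k) (binomial-absorption n (suc k))) ⟩
  a ℕ.+ (suc n ℕ.* (n C k) ℕ.+ suc n ℕ.* (n C suc k))
    ≡⟨ cong (a ℕ.+_) (ℕ.*-distribˡ-+ (suc n) (n C k) (n C suc k)) ⟨
  a ℕ.+ suc n ℕ.* ((n C k) ℕ.+ (n C suc k))
    ≡⟨ cong (λ z → a ℕ.+ suc n ℕ.* z) (nCk+nC[k+1]≡[n+1]C[k+1] n k) ⟩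
  suc (suc n) ℕ.* a ∎
  where
  open ≡.≡-Reasoning
  a = suc n C suc k
  b = suc n C suc (suc k)
  regroup : ∀ k a b → suc (suc k) ℕ.* (a ℕ.+ b) ≡ a ℕ.+ (suc k ℕ.* a ℕ.+ suc (suc k) ℕ.* b)
  regroup = ℕ.solve-∀

-- By absorption the prime divides `suc k` times the coefficient, and it is too large to divide
-- `suc k`.
prime∣binomial : ∀ {n} → Prime (suc n) → ∀ {k} → k < n → suc n ∣ (suc n C suc k)
prime∣binomial {n} isPrime {k} k<n
  with euclidsLemma (suc k) (suc n C suc k) isPrime
         (divides (n C k) (≡.trans (binomial-absorption n k) (ℕ.*-comm (suc n) (n C k))))
... | inj₁ p∣1+k = contradiction (∣⇒≤ p∣1+k) (ℕ.<⇒≱ (s≤s k<n))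
... | inj₂ p∣C   = p∣C

module Frobenius {c ℓ} (R : CommutativeRing c ℓ) where

  open CommutativeRing R hiding (zero)
  open import Algebra.Properties.Semiring.Mult semiring
    using (×-assoc-*; ×-congʳ; ×-homo-1; ×1-homo-*) renaming (_×_ to _·_)
  open import Algebra.Properties.CommutativeSemiring.Exp commutativeSemiring
  open import Algebra.Properties.CommutativeSemiring.Binomial commutativeSemiring
  open import Algebra.Properties.Semiring.Sum semiring
  open import Relation.Binary.Reasoning.Setoid setoid

  module _ {p} (isPrime : Prime p) (p·1≈0 : p · 1# ≈ 0#) where

    multiple·≈0 : ∀ {k} x → p ∣ k → k · x ≈ 0#
    multiple·≈0 x (divides m ≡.refl) = begin
      (m ℕ.* p) · x               ≈⟨ ×-congʳ (m ℕ.* p) (*-identityˡ x) ⟨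
      (m ℕ.* p) · (1# * x)        ≈⟨ ×-assoc-* (m ℕ.* p) 1# x ⟨
      (m ℕ.* p) · 1# * x          ≈⟨ *-congʳ (×1-homo-* m p) ⟩
      (m · 1#) * (p · 1#) * x     ≈⟨ *-congʳ (*-congˡ p·1≈0) ⟩
      (m · 1#) * 0# * x           ≈⟨ *-congʳ (zeroʳ _) ⟩
      0# * x                      ≈⟨ zeroˡ x ⟩
      0#                          ∎

    -- Only the two extreme terms of the binomial expansion survive: the other coefficients are
    -- divisible by p.
    ^p-distrib-+ : ∀ x y → (x + y) ^ p ≈ x ^ p + y ^ p
    ^p-distrib-+ x y = go p isPrime (λ {k} → multiple·≈0 {k})
      where
      go : ∀ p → Prime p → (∀ {k} x → p ∣ k → k · x ≈ 0#) → (x + y) ^ p ≈ x ^ p + y ^ p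
      go (suc n) isPrime vanish = begin
        (x + y) ^ suc n                            ≈⟨ theorem (suc n) x y ⟩
        t zero + sum (t ∘ suc)                     ≈⟨ +-congˡ (sum-init-last (t ∘ suc)) ⟩
        t zero + (sum (t ∘ suc ∘ inject₁) + t (fromℕ (suc n)))
          ≈⟨ +-cong head≈ (+-cong (trans (sum-cong-≋ middle≈0) (sum-replicate-zero n)) last≈) ⟩
        y ^ suc n + (0# + x ^ suc n)               ≈⟨ +-congˡ (+-identityˡ _) ⟩
        y ^ suc n + x ^ suc n                      ≈⟨ +-comm _ _ ⟩
        x ^ suc n + y ^ suc n                      ∎
        where
        t = binomialTerm x y (suc n)
        head≈ : t zero ≈ y ^ suc n
        head≈ = trans (×-homo-1 _) (*-identityˡ _)
        middle≈0 : ∀ i → t (suc (inject₁ i)) ≈ 0#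
        middle≈0 i rewrite Fin.toℕ-inject₁ i =
          vanish _ (prime∣binomial isPrime (Fin.toℕ<n i))
        last≈ : t (fromℕ (suc n)) ≈ x ^ suc n
        last≈ rewrite Fin.toℕ-fromℕ n | nCn≡1 (suc n) | ℕ.n∸n≡0 n =
          trans (×-homo-1 _) (*-identityʳ _)

    ^p^-distrib-+ : ∀ i x y → (x + y) ^ (p ℕ.^ i) ≈ x ^ (p ℕ.^ i) + y ^ (p ℕ.^ i)
    ^p^-distrib-+ zero x y = distribʳ 1# x y
    ^p^-distrib-+ (suc i) x y = begin
      (x + y) ^ (p ℕ.* P)               ≈⟨ ^-assocʳ (x + y) p P ⟨
      ((x + y) ^ p) ^ P                 ≈⟨ ^-congˡ P (^p-distrib-+ x y) ⟩
      (x ^ p + y ^ p) ^ P               ≈⟨ ^p^-distrib-+ i (x ^ p) (y ^ p) ⟩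
      (x ^ p) ^ P + (y ^ p) ^ P         ≈⟨ +-cong (^-assocʳ x p P) (^-assocʳ y p P) ⟩
      x ^ (p ℕ.* P) + y ^ (p ℕ.* P)     ∎
      where P = p ℕ.^ i

-- Polynomials acting on sequences, and the quotient by an annihilator.

module Recurrences {c ℓ} (F : CommutativeRing c ℓ) where

  open CommutativeRing F hiding (zero)
  open import Algebra.Properties.Ring ring using (-1*x≈-x)
  open import Algebra.Properties.CommutativeSemigroup +-commutativeSemigroup using (interchange)
  open import Algebra.Properties.CommutativeSemigroup *-commutativeSemigroup using (x∙yz≈y∙xz)

  infixl 6 _⊕_
  infixl 7 _⊗_
  infixr 8 _▷_

  -- Unnormalised expressions: only the action on sequences matters.
  data Poly : Set c where
    con     : Carrier → Poly
    X       : Poly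
    _⊕_ _⊗_ : Poly → Poly → Poly

  Sequence : Set c
  Sequence = ℕ → Carrier

  infix 4 _≋_
  _≋_ : Sequence → Sequence → Set ℓ
  v ≋ w = ∀ i → v i ≈ w i

  _▷_ : Poly → Sequence → Sequence
  (con a ▷ v) i   = a * v i
  (X ▷ v) i       = v (suc i)
  ((f ⊕ g) ▷ v) i = (f ▷ v) i + (g ▷ v) i
  (f ⊗ g) ▷ v     = f ▷ g ▷ v

  ▷-cong : ∀ f {v w} → v ≋ w → f ▷ v ≋ f ▷ w
  ▷-cong (con a) e i = *-congˡ (e i)
  ▷-cong X       e i = e (suc i)
  ▷-cong (f ⊕ g) e i = +-cong (▷-cong f e i) (▷-cong g e i)
  ▷-cong (f ⊗ g) e   = ▷-cong f (▷-cong g e)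

  ▷-+ : ∀ f v w → f ▷ (λ i → v i + w i) ≋ λ i → (f ▷ v) i + (f ▷ w) i
  ▷-+ (con a) v w i = distribˡ a (v i) (w i)
  ▷-+ X       v w i = refl
  ▷-+ (f ⊕ g) v w i = trans (+-cong (▷-+ f v w i) (▷-+ g v w i)) (interchange _ _ _ _)
  ▷-+ (f ⊗ g) v w i = trans (▷-cong f (▷-+ g v w) i) (▷-+ f (g ▷ v) (g ▷ w) i)

  ▷-* : ∀ f a v → f ▷ (λ i → a * v i) ≋ λ i → a * (f ▷ v) i
  ▷-* (con b) a v i = x∙yz≈y∙xz b a (v i)
  ▷-* X       a v i = refl
  ▷-* (f ⊕ g) a v i = trans (+-cong (▷-* f a v i) (▷-* g a v i)) (sym (distribˡ a _ _))
  ▷-* (f ⊗ g) a v i = trans (▷-cong f (▷-* g a v) i) (▷-* f a (g ▷ v) i)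

  ▷-shift : ∀ f v → f ▷ (v ∘ suc) ≋ (f ▷ v) ∘ suc
  ▷-shift (con b) v i = refl
  ▷-shift X       v i = refl
  ▷-shift (f ⊕ g) v i = +-cong (▷-shift f v i) (▷-shift g v i)
  ▷-shift (f ⊗ g) v i = trans (▷-cong f (▷-shift g v) i) (▷-shift f (g ▷ v) i)

  -- Every operator commutes with scalars and with the shift, and these generate all operators.
  ▷-comm : ∀ f g v → f ▷ g ▷ v ≋ g ▷ f ▷ v
  ▷-comm f (con a) v i = ▷-* f a v i
  ▷-comm f X       v i = ▷-shift f v i
  ▷-comm f (g ⊕ h) v i = trans (▷-+ f (g ▷ v) (h ▷ v) i) (+-cong (▷-comm f g v i) (▷-comm f h v i))
  ▷-comm f (g ⊗ h) v i = trans (▷-comm f g (h ▷ v) i) (▷-cong g (▷-comm f h v) i)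

  infix 4 _≈[_]_
  -- Congruence modulo the annihilator of `w`. The record keeps `f`, `w` and `g` inferable, since
  -- `_▷_` computes.
  record _≈[_]_ (f : Poly) (w : Sequence) (g : Poly) : Set ℓ where
    constructor act
    field actions : f ▷ w ≋ g ▷ w
  open _≈[_]_ public

  Poly/Ann : Sequence → CommutativeRing c ℓ
  Poly/Ann w = record
    { Carrier = Poly
    ; _≈_ = _≈[ w ]_
    ; _+_ = _⊕_
    ; _*_ = _⊗_
    ; -_  = con (- 1#) ⊗_
    ; 0#  = con 0#
    ; 1#  = con 1#
    ; isCommutativeRing = record
      { isRing = record
        { +-isAbelianGroup = record
          { isGroup = record
            { isMonoid = record
              { isSemigroup = record
                { isMagma = record
                  { isEquivalence = record
                    { refl  = act λ i → refl
                    ; sym   = λ (act e) → act λ i → sym (e i)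
                    ; trans = λ (act e) (act e′) → act λ i → trans (e i) (e′ i)
                    }
                  ; ∙-cong = λ (act e) (act e′) → act λ i → +-cong (e i) (e′ i)
                  }
                ; assoc = λ f g h → act λ i → +-assoc _ _ _
                }
              ; identity = (λ f → act λ i → trans (+-congʳ (zeroˡ _)) (+-identityˡ _))
                         , (λ f → act λ i → trans (+-congˡ (zeroˡ _)) (+-identityʳ _))
              }
            ; inverse = (λ f → act λ i → trans (trans (+-congʳ (-1*x≈-x _)) (-‿inverseˡ _)) (sym (zeroˡ _)))
                      , (λ f → act λ i → trans (trans (+-congˡ (-1*x≈-x _)) (-‿inverseʳ _)) (sym (zeroˡ _)))
            ; ⁻¹-cong = λ (act e) → act λ i → *-congˡ (e i)
            }
          ; comm = λ f g → act λ i → +-comm _ _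
          }
        -- The hypotheses concern `w` only, so commutation brings each factor next to `w` before it
        -- is replaced.
        ; *-cong = λ {f} {f′} {g} {g′} (act e) (act e′) → act λ i →
            trans (▷-cong f e′ i) (trans (▷-comm f g′ w i) (trans (▷-cong g′ e i) (▷-comm g′ f′ w i)))
        ; *-assoc = λ f g h → act λ i → refl
        ; *-identity = (λ f → act λ i → *-identityˡ _)
                     , (λ f → act λ i → trans (▷-* f 1# w i) (*-identityˡ _))
        ; distrib = (λ f g h → act λ i → ▷-+ f (g ▷ w) (h ▷ w) i) , (λ f g h → act λ i → refl)
        }
      ; *-comm = λ f g → act λ i → ▷-comm f g w i
      }
    }

  -- What kills `w` also kills `e ▷ w`, by commutation. Passing to `e ▷ w` thus enlarges the
  -- annihilator and preserves all identities found so far.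
  ≈-restrict : ∀ e {f g w} → f ≈[ w ] g → f ≈[ e ▷ w ] g
  ≈-restrict e {f} {g} {w} (act f≈g) = act λ i →
    trans (▷-comm f e w i) (trans (▷-cong e f≈g i) (▷-comm e g w i))

-- Prime fields, and linear combinations of powers of `X` over them.

record PrimeField (p : ℕ) : Set₁ where
  field
    isPrime : Prime p
    ring    : CommutativeRing 0ℓ 0ℓ
  open CommutativeRing ring hiding (ring; zero) public
  open Multiples semiring using () renaming (_×_ to _·_) public
  field
    _≈?_              : ∀ x y → Dec (x ≈ y)
    1≉0               : ¬ 1# ≈ 0#
    p·1≈0             : p · 1# ≈ 0#
    numeral           : ∀ x → ∃ λ (i : Fin p) → x ≈ toℕ i · 1#
    numeral-injective : ∀ {i j : Fin p} → toℕ i · 1# ≈ toℕ j · 1# → i ≡ j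
    invertible        : ∀ x → ¬ x ≈ 0# → ∃ λ s → s * x ≈ 1#

module Span {p} (𝔽 : PrimeField p) (w : ℕ → PrimeField.Carrier 𝔽) where

  private module F = PrimeField 𝔽
  open F using (isPrime)
  open Recurrences F.ring
  open CommutativeRing (Poly/Ann w) hiding (zero) public
  open import Algebra.Properties.CommutativeSemiring.Exp commutativeSemiring public
  open import Algebra.Properties.Semiring.Mult semiring using () renaming (_×_ to _·_)
  open import Algebra.Properties.CommutativeSemigroup +-commutativeSemigroup using (interchange)
  open import Algebra.Properties.CommutativeSemigroup *-commutativeSemigroup using (x∙yz≈y∙xz)
  open import Relation.Binary.Reasoning.Setoid setoid

  con-cong : ∀ {a b} → a F.≈ b → con a ≈ con b
  con-cong e = act λ i → F.*-congʳ e

  con-+ : ∀ a b → con (a F.+ b) ≈ con a + con b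
  con-+ a b = act λ i → F.distribʳ _ a b

  con-* : ∀ a b → con (a F.* b) ≈ con a * con b
  con-* a b = act λ i → F.*-assoc a b _

  con-· : ∀ k → con (k F.· F.1#) ≈ k · 1#
  con-· zero    = refl
  con-· (suc k) = trans (con-+ _ _) (+-congˡ (con-· k))

  -- Combinations of the first d powers of `X`. The derivation stores the coefficients, so that
  -- `evalAt` can substitute another element for `X`.
  data Span : ℕ → Poly → Set where
    nil  : ∀ {f} → f ≈ 0# → Span 0 f
    snoc : ∀ {d f g} → Span d g → ∀ t → f ≈ g + con t * X ^ d → Span (suc d) f

  span-resp : ∀ {d f g} → f ≈ g → Span d f → Span d g
  span-resp f≈g (nil e)      = nil (trans (sym f≈g) e)
  span-resp f≈g (snoc s t e) = snoc s t (trans (sym f≈g) e)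

  span-+ : ∀ {d f g} → Span d f → Span d g → Span d (f + g)
  span-+ (nil e) (nil e′) = nil (trans (+-cong e e′) (+-identityˡ 0#))
  span-+ (snoc s t e) (snoc s′ t′ e′) = snoc (span-+ s s′) (t F.+ t′)
    (trans (+-cong e e′) (trans (interchange _ _ _ _)
      (+-congˡ (trans (sym (distribʳ _ _ _)) (*-congʳ (sym (con-+ t t′)))))))

  span-con : ∀ {d f} a → Span d f → Span d (con a * f)
  span-con a (nil e)      = nil (trans (*-congˡ e) (zeroʳ _))
  span-con a (snoc s t e) = snoc (span-con a s) (a F.* t)
    (trans (*-congˡ e) (trans (distribˡ _ _ _)
      (+-congˡ (trans (sym (*-assoc _ _ _)) (*-congʳ (sym (con-* a t)))))))

  span-weaken : ∀ {d f} → Span d f → Span (suc d) f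
  span-weaken s = snoc s F.0# (sym (trans (+-congˡ (zeroˡ _)) (+-identityʳ _)))

  span-shift : ∀ {d f} → Span d f → Span (suc d) (X * f)
  span-shift (nil e) = span-weaken (nil (trans (*-congˡ e) (zeroʳ X)))
  span-shift (snoc s t e) = snoc (span-shift s) t
    (trans (*-congˡ e) (trans (distribˡ _ _ _) (+-congˡ (x∙yz≈y∙xz X (con t) _))))

  span-1 : ∀ d → Span (suc d) 1#
  span-1 zero    = snoc (nil refl) F.1# (sym (trans (+-identityˡ _) (*-identityˡ 1#)))
  span-1 (suc d) = span-weaken (span-1 d)

  module _ {d} (closed : Span d (X ^ d)) where

    -- The shift creates a single power out of range, X ^ d, which `closed` expresses through the
    -- lower ones.
    span-X : ∀ {f} → Span d f → Span d (X * f)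
    span-X s with span-shift s
    ... | snoc s′ t e = span-resp (sym e) (span-+ s′ (span-con t closed))

    span-* : ∀ f {g} → Span d g → Span d (f * g)
    span-* (con a) s = span-con a s
    span-* X       s = span-X s
    span-* (f ⊕ g) s = span-resp (sym (distribʳ _ f g)) (span-+ (span-* f s) (span-* g s))
    span-* (f ⊗ g) s = span-resp (sym (*-assoc f g _)) (span-* f (span-* g s))

  -- The span absorbs multiplication and contains 1; for d = 0 that membership is `closed` itself,
  -- as X ^ 0 is 1.
  span-all : ∀ {d} → Span d (X ^ d) → ∀ f → Span d f
  span-all {zero}  closed f = span-resp (*-identityʳ f) (span-* closed f closed)
  span-all {suc d} closed f = span-resp (*-identityʳ f) (span-* closed f (span-1 d))

  evalAt : ∀ {d f} → Span d f → Poly → Poly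
  evalAt (nil _)                x = 0#
  evalAt (snoc {d = d} s t _) x = evalAt s x + con t * x ^ d

  evalAt-X : ∀ {d f} (s : Span d f) → evalAt s X ≈ f
  evalAt-X (nil e)      = sym e
  evalAt-X (snoc s t e) = trans (+-congʳ (evalAt-X s)) (sym e)

  open MonicPolynomials (Poly/Ann w)

  monic-+evalAt : ∀ {m h d f} → Monic m h → d ≤ m → (s : Span d f) →
                  Monic m (λ x → h x + evalAt s x)
  monic-+evalAt H _ (nil _) = monic-resp (λ x → sym (+-identityʳ _)) H
  monic-+evalAt H d<m (snoc s t _) =
    monic-resp (λ x → +-assoc _ _ _) (monic-addTerm (monic-+evalAt H (ℕ.<⇒≤ d<m) s) d<m (con t))

  open Frobenius (Poly/Ann w) using (^p^-distrib-+)

  frobenius-+ : ∀ i f g → (f + g) ^ (p ℕ.^ i) ≈ f ^ (p ℕ.^ i) + g ^ (p ℕ.^ i)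
  frobenius-+ = ^p^-distrib-+ isPrime (trans (sym (con-· p)) (con-cong F.p·1≈0))

  1^ : ∀ k → 1# ^ k ≈ 1#
  1^ zero    = refl
  1^ (suc k) = trans (*-identityˡ _) (1^ k)

  p^≢0 : ∀ i → NonZero (p ℕ.^ i)
  p^≢0 i = ℕ.m^n≢0 p i {{prime⇒nonZero isPrime}}

  0^ : ∀ k → .{{NonZero k}} → 0# ^ k ≈ 0#
  0^ (suc k) = zeroˡ _

  -- Fermat's little theorem: a constant is a sum of ones, and Frobenius is additive and fixes 1.
  frobenius-con : ∀ i a → con a ^ (p ℕ.^ i) ≈ con a
  frobenius-con i a with k , a≈k ← F.numeral a = begin
    con a ^ (p ℕ.^ i)         ≈⟨ ^-congˡ (p ℕ.^ i) (trans (con-cong a≈k) (con-· (toℕ k))) ⟩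
    (toℕ k · 1#) ^ (p ℕ.^ i)  ≈⟨ frobenius-· (toℕ k) ⟩
    toℕ k · 1#                ≈⟨ trans (con-cong a≈k) (con-· (toℕ k)) ⟨
    con a                     ∎
    where
    frobenius-· : ∀ k → (k · 1#) ^ (p ℕ.^ i) ≈ k · 1#
    frobenius-· zero    = 0^ (p ℕ.^ i) {{p^≢0 i}}
    frobenius-· (suc k) = trans (frobenius-+ i 1# (k · 1#)) (+-cong (1^ (p ℕ.^ i)) (frobenius-· k))

  ^-swap : ∀ x k l → (x ^ k) ^ l ≈ (x ^ l) ^ k
  ^-swap x k l = trans (^-assocʳ x k l) (trans (^-congʳ x (ℕ.*-comm k l)) (sym (^-assocʳ x l k)))

  -- The coefficients lie in the prime field and are fixed, so Frobenius moves only the argument and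
  -- sends roots to roots.
  evalAt-frobenius : ∀ i {d f} (s : Span d f) x → evalAt s x ^ (p ℕ.^ i) ≈ evalAt s (x ^ (p ℕ.^ i))
  evalAt-frobenius i (nil _) x = 0^ (p ℕ.^ i) {{p^≢0 i}}
  evalAt-frobenius i (snoc {d = d} s t _) x =
    trans (frobenius-+ i _ _) (+-cong (evalAt-frobenius i s x)
      (trans (^-distrib-* _ _ (p ℕ.^ i)) (*-cong (frobenius-con i t) (^-swap x d (p ℕ.^ i)))))

  -- The polynomials fixed by a power of Frobenius form a subring containing the constants.
  frobenius-fixes : ∀ i → X ^ (p ℕ.^ i) ≈ X → ∀ f → f ^ (p ℕ.^ i) ≈ f
  frobenius-fixes i fixX (con a) = frobenius-con i a
  frobenius-fixes i fixX X       = fixX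
  frobenius-fixes i fixX (f ⊕ g) =
    trans (frobenius-+ i f g) (+-cong (frobenius-fixes i fixX f) (frobenius-fixes i fixX g))
  frobenius-fixes i fixX (f ⊗ g) =
    trans (^-distrib-* f g (p ℕ.^ i)) (*-cong (frobenius-fixes i fixX f) (frobenius-fixes i fixX g))

  -- The coefficients are the base-p digits of the index, the leading digit going to the highest
  -- power.
  value : ∀ d → Fin (p ℕ.^ d) → Poly
  value zero    _ = 0#
  value (suc d) m = let t , r = remQuot {p} (p ℕ.^ d) m in value d r + con (toℕ t F.· F.1#) * X ^ d

  span-value : ∀ d m → Span d (value d m)
  span-value zero    m = nil refl
  span-value (suc d) m = snoc (span-value d (proj₂ (remQuot {p} (p ℕ.^ d) m))) _ refl

  code : ∀ {d f} → Span d f → ∃ λ m → f ≈ value d m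
  code (nil e) = zero , e
  code (snoc {d} {f} s t e) with r , g≈ ← code s | i , t≈ ← F.numeral t =
    combine i r , (begin
      f                                           ≈⟨ trans e (+-cong g≈ (*-congʳ (con-cong t≈))) ⟩
      value d r + con (toℕ i F.· F.1#) * X ^ d     ≡⟨ cong (λ (j , u) → value d u + con (toℕ j F.· F.1#) * X ^ d) (Fin.remQuot-combine i r) ⟨
      value (suc d) (combine i r)                 ∎)

  open import Algebra.Properties.Group +-group using (\\-leftDividesʳ; ∙-cancelʳ)

  -- Two different expressions of length d + 1 would express X ^ j through lower powers for some j ≤ d.
  value-injective : ∀ d → (∀ {j} → j < d → ¬ Span j (X ^ j)) → Injective _≡_ _≈_ (value d)
  value-injective zero _ {zero} {zero} _ = ≡.refl
  value-injective (suc d) independent {m} {m′} v≈v′ =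
    ≡.trans (≡.sym (Fin.combine-remQuot {p} (p ℕ.^ d) m))
      (≡.trans (cong (uncurry combine) (compare _ _ v≈v′)) (Fin.combine-remQuot {p} (p ℕ.^ d) m′))
    where
    compare : ∀ (x y : Fin p × Fin (p ℕ.^ d)) →
              value d (proj₂ x) + con (toℕ (proj₁ x) F.· F.1#) * X ^ d ≈
              value d (proj₂ y) + con (toℕ (proj₁ y) F.· F.1#) * X ^ d → x ≡ y
    compare (t , r) (t′ , r′) e with t Fin.≟ t′
    ... | yes ≡.refl = cong (t ,_) (value-injective d (independent ∘ ℕ.m<n⇒m<1+n) (∙-cancelʳ _ _ _ e))
    ... | no t≢t′ = contradiction X^d∈span (independent ℕ.≤-refl)
      where
      T = toℕ t F.· F.1#
      T′ = toℕ t′ F.· F.1#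
      b = T F.- T′
      b-invertible = F.invertible b λ b≈0 → t≢t′ (F.numeral-injective (x∙y⁻¹≈ε⇒x≈y T T′ b≈0))
        where open import Algebra.Properties.Group F.+-group using (x∙y⁻¹≈ε⇒x≈y)
      s = proj₁ b-invertible
      T≈b+T′ : T F.≈ b F.+ T′
      T≈b+T′ = F.sym (F.trans (F.+-assoc T (F.- T′) T′)
                 (F.trans (F.+-congˡ (F.-‿inverseˡ T′)) (F.+-identityʳ T)))
      r+bX≈r′ : value d r + con b * X ^ d ≈ value d r′
      r+bX≈r′ = ∙-cancelʳ (con T′ * X ^ d) _ _ (begin
        value d r + con b * X ^ d + con T′ * X ^ d    ≈⟨ +-assoc _ _ _ ⟩
        value d r + (con b * X ^ d + con T′ * X ^ d)  ≈⟨ +-congˡ (distribʳ _ _ _) ⟨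
        value d r + (con b + con T′) * X ^ d          ≈⟨ +-congˡ (*-congʳ (trans (con-cong T≈b+T′) (con-+ b T′))) ⟨
        value d r + con T * X ^ d                     ≈⟨ e ⟩
        value d r′ + con T′ * X ^ d                   ∎)
      sbX≈X : con s * (con b * X ^ d) ≈ X ^ d
      sbX≈X = begin
        con s * (con b * X ^ d)  ≈⟨ *-assoc _ _ _ ⟨
        con s * con b * X ^ d    ≈⟨ *-congʳ (con-* s b) ⟨
        con (s F.* b) * X ^ d    ≈⟨ *-congʳ (con-cong (proj₂ b-invertible)) ⟩
        1# * X ^ d               ≈⟨ *-identityˡ _ ⟩
        X ^ d                    ∎
      X^d∈span : Span d (X ^ d)
      X^d∈span = span-resp (trans (*-congˡ (trans (+-congˡ (sym r+bX≈r′)) (\\-leftDividesʳ _ _))) sbX≈X)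
        (span-con s (span-+ (span-con (F.- F.1#) (span-value d r)) (span-value d r′)))

-- Construction of the field with p ^ a elements.

record FiniteIntegralDomain (q : ℕ) : Set₁ where
  field
    ring : CommutativeRing 0ℓ 0ℓ
  open CommutativeRing ring hiding (ring; zero) public
  field
    cancel            : ∀ x y z → x * z ≈ y * z → x ≈ y ⊎ z ≈ 0#
    element           : Fin q → Carrier
    element-injective : Injective _≡_ _≈_ element
    code              : Carrier → Fin q
    element-code      : ∀ x → x ≈ element (code x)

module GaloisField {p} (𝔽 : PrimeField p) (a m : ℕ) (q≡2+m : p ℕ.^ a ≡ 2 ℕ.+ m) where

  private
    module F = PrimeField 𝔽
    module Q (w : ℕ → F.Carrier) = Span 𝔽 w
    -- The period is n = q - 1, while m = q - 2 is the exponent that produces inverses.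
    n = suc m
  open Recurrences F.ring
  open F using (isPrime)

  1<p : 1 < p
  1<p = ℕ.nonTrivial⇒n>1 p {{prime⇒nonTrivial isPrime}}

  1<q : 1 < p ℕ.^ a
  1<q = subst (1 <_) (≡.sym q≡2+m) (s≤s (s≤s z≤n))

  infixr 9 _^[_]_
  _^[_]_ : Poly → Sequence → ℕ → Poly
  f ^[ w ] k = Q._^_ w f k

  -- The power operation belongs to the ring `Poly/Ann w`, yet the expression it builds does not
  -- involve `w`; this lets powers move between sequences.
  ^-independent : ∀ v w f k → f ^[ v ] k ≡ f ^[ w ] k
  ^-independent v w f zero    = ≡.refl
  ^-independent v w f (suc k) = cong (f ⊗_) (^-independent v w f k)

  X^-▷ : ∀ w k v i → (X ^[ w ] k ▷ v) i F.≈ v (k ℕ.+ i)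
  X^-▷ w zero    v i = F.*-identityˡ (v i)
  X^-▷ w (suc k) v i = F.trans (X^-▷ w k v (suc i)) (F.reflexive (cong v (ℕ.+-suc k i)))

  Periodic : Sequence → Set
  Periodic w = X ^[ w ] n ≈[ w ] con F.1#

  Nontrivial : Sequence → Set
  Nontrivial w = ¬ con F.1# ≈[ w ] con F.0#

  Unit : Sequence → Poly → Set
  Unit w f = ∃ λ g → g ⊗ f ≈[ w ] con F.1#

  infix 4 _↠_
  -- The identity on expressions induces a surjection from `Poly/Ann v` onto `Poly/Ann w`.
  _↠_ : Sequence → Sequence → Set
  v ↠ w = ∀ {f g} → f ≈[ v ] g → f ≈[ w ] g

  periodic-↠ : ∀ {v w} → v ↠ w → Periodic v → Periodic w
  periodic-↠ {v} {w} v↠w per = subst (λ f → f ≈[ w ] con F.1#) (^-independent v w X n) (v↠w per)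

  unit-↠ : ∀ {v w f} → v ↠ w → Unit v f → Unit w f
  unit-↠ v↠w (g , e) = g , v↠w e

  module _ {w} (per : Periodic w) where

    open Q w

    -- Periodicity gives X ^ q = X · X ^ n = X, and a power of Frobenius that fixes `X` fixes
    -- everything.
    fermat : ∀ f → f ^ (p ℕ.^ a) ≈ f
    fermat = frobenius-fixes a (subst (λ k → X ^ k ≈ X) (≡.sym q≡2+m)
      (trans (*-congˡ per) (*-identityʳ X)))

    regular : ∀ f → ∃ λ g → (g * f) * f ≈ f
    regular f = f ^ m , trans (*-comm _ f) (trans (*-congˡ (*-comm _ f))
      (subst (λ k → f ^ k ≈ f) q≡2+m (fermat f)))

    -- The equation g f f = f on `w` says precisely that g f acts as 1 on `f ▷ w`.
    unit-▷ : ∀ f → Unit (f ▷ w) f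
    unit-▷ f with g , act e ← regular f = g , act λ i → F.trans (e i) (F.sym (F.*-identityˡ _))

    ▷-periodic : ∀ f i → (f ▷ w) (n ℕ.+ i) F.≈ (f ▷ w) i
    ▷-periodic f i = F.trans (F.sym (X^-▷ w n (f ▷ w) i))
      (actions (trans (*-congʳ {f} per) (*-identityˡ f)) i)

    ▷-mod : ∀ f i → (f ▷ w) i F.≈ (f ▷ w) (i ℕ.% n)
    ▷-mod f i = F.trans (F.reflexive (cong (f ▷ w) (≡.trans (m≡m%n+[m/n]*n i n) (ℕ.+-comm (i ℕ.% n) _))))
      (multiples (i ℕ./ n))
      where
      multiples : ∀ k → (f ▷ w) (k ℕ.* n ℕ.+ i ℕ.% n) F.≈ (f ▷ w) (i ℕ.% n)
      multiples zero    = F.refl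
      multiples (suc k) = F.trans (F.reflexive (cong (f ▷ w) (ℕ.+-assoc n (k ℕ.* n) _)))
        (F.trans (▷-periodic f _) (multiples k))

    -- Both actions are periodic, so comparing their first n terms decides equality.
    _≟_ : ∀ f g → Dec (f ≈ g)
    f ≟ g = map′
      (λ h → act λ i → F.trans (▷-mod f i) (F.trans (h (m%n<n i n)) (F.sym (▷-mod g i))))
      (λ (act e) {i} _ → e i)
      (ℕ.allUpTo? (λ i → (f ▷ w) i F.≈? (g ▷ w) i) n)

    span? : ∀ d f → Dec (Span d f)
    span? d f = map′ (λ (i , e) → span-resp (sym e) (span-value d i)) code (Fin.any? λ i → f ≟ value d i)

  -- Replacing w by f ▷ w whenever the latter is non-zero turns f into a unit.
  makeZeroOrUnit : ∀ fs {w} → Periodic w → Nontrivial w → ∃ λ w′ → w ↠ w′ × Nontrivial w′ ×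
               All (λ f → f ≈[ w′ ] con F.0# ⊎ Unit w′ f) fs
  makeZeroOrUnit [] {w} per nt = w , (λ e → e) , nt , []
  makeZeroOrUnit (f ∷ fs) {w} per nt with _≟_ per f (con F.0#)
  ... | yes f≈0 =
    let w′ , w↠w′ , nt′ , all = makeZeroOrUnit fs per nt
    in w′ , w↠w′ , nt′ , inj₁ (w↠w′ f≈0) ∷ all
  ... | no f≉0 =
    let w′ , fw↠w′ , nt′ , all = makeZeroOrUnit fs (periodic-↠ (≈-restrict f) per) nt-f
    in w′ , (λ e → fw↠w′ (≈-restrict f e)) , nt′ , inj₂ (unit-↠ fw↠w′ (unit-▷ per f)) ∷ all
    where
    nt-f : Nontrivial (f ▷ w)
    nt-f (act e) = f≉0 (trans (sym (*-identityˡ f)) (trans (act e) (zeroˡ f)))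
      where open Q w

  -- Non-vanishing of the product of the X ^ (p ^ t - 1) - 1.

  impulses : Sequence
  impulses i with n ℕ.∣? i
  ... | yes _ = F.1#
  ... | no  _ = F.0#

  impulses-periodic : Periodic impulses
  impulses-periodic = act λ i → F.trans (X^-▷ impulses n impulses i)
    (F.trans (shifted i) (F.sym (F.*-identityˡ _)))
    where
    shifted : ∀ i → impulses (n ℕ.+ i) F.≈ impulses i
    shifted i with n ℕ.∣? (n ℕ.+ i) | n ℕ.∣? i
    ... | yes _ | yes _ = F.refl
    ... | no _  | no _  = F.refl
    ... | yes d | no ∤i = contradiction (ℕ.∣m+n∣m⇒∣n d ℕ.∣-refl) ∤i
    ... | no ∤d | yes d = contradiction (ℕ.∣m∣n⇒∣m+n ℕ.∣-refl d) ∤d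

  -- For f monic of degree < n, f ▷ impulses has leading position n − deg f.
  record Leading (j : ℕ) (v : Sequence) : Set where
    field
      positive : 1 ≤ j
      at       : v j F.≈ F.1#
      below    : ∀ {i} → 1 ≤ i → i < j → v i F.≈ F.0#
  open Leading

  impulses-leading : Leading n impulses
  impulses-leading .positive = s≤s z≤n
  impulses-leading .at with n ℕ.∣? n
  ... | yes _ = F.refl
  ... | no ∤n = contradiction ℕ.∣-refl ∤n
  impulses-leading .below {suc i} _ i<n with n ℕ.∣? suc i
  ... | yes d = contradiction (∣⇒≤ d) (ℕ.<⇒≱ i<n)
  ... | no _  = F.refl

  leading⇒nontrivial : ∀ {j v} → Leading j v → Nontrivial v
  leading⇒nontrivial {j} {v} lead (act e) = F.1≉0 (F.trans (F.sym (F.trans (F.*-identityˡ (v j)) (at lead)))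
    (F.trans (e j) (F.zeroˡ (v j))))

  -- At exponents p ^ t - 1 with 1 ≤ t < a, the invertibility of these factors prevents `X` from
  -- being fixed by a smaller power of Frobenius.
  powerMinusOne : ℕ → Poly
  powerMinusOne t = X ^[ impulses ] t ⊕ con (F.- F.1#)

  -- The operator yields v (t + i) - v i. For 1 ≤ i ≤ j the second term lies before position t + j
  -- and vanishes, so the leading position moves down by t.
  leading-▷ : ∀ {t j v} → 1 ≤ t → 1 ≤ j → Leading (t ℕ.+ j) v → Leading j (powerMinusOne t ▷ v)
  leading-▷ {t} {j} {v} 1≤t 1≤j lead = record
    { positive = 1≤j
    ; at = F.trans (difference (below lead 1≤j (ℕ.m<n+m j 1≤t))) (at lead)
    ; below = λ {i} 1≤i i<j → F.trans
        (difference (below lead 1≤i (ℕ.<-≤-trans i<j (ℕ.m≤n+m j t))))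
        (below lead (ℕ.≤-trans 1≤i (ℕ.m≤n+m i t)) (ℕ.+-monoʳ-< t i<j))
    }
    where
    difference : ∀ {i} → v i F.≈ F.0# → (powerMinusOne t ▷ v) i F.≈ v (t ℕ.+ i)
    difference v≈0 = F.trans (F.+-cong (X^-▷ impulses t v _) (F.trans (F.*-congˡ v≈0) (F.zeroʳ _)))
      (F.+-identityʳ _)

  -- Stages run down from k = a to k = 1, each applying one more factor. `bound` leaves room for the
  -- next one, of degree p ^ (k - 1) - 1, to keep the leading position positive.
  record Stage (k : ℕ) : Set where
    field
      sequence : Sequence
      periodic : Periodic sequence
      position : ℕ
      leading  : Leading position sequence
      bound    : p ℕ.^ k ≤ suc position
      units    : ∀ {t} → k ≤ t → t < a → Unit sequence (powerMinusOne (ℕ.pred (p ℕ.^ t)))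

  stage : ∀ b k → b ℕ.+ k ≡ a → 1 ≤ k → Stage k
  stage zero k ≡.refl _ = record
    { sequence = impulses
    ; periodic = impulses-periodic
    ; position = n
    ; leading  = impulses-leading
    ; bound    = ℕ.≤-reflexive q≡2+m
    ; units    = λ k≤t t<k → contradiction k≤t (ℕ.<⇒≱ t<k)
    }
  stage (suc b) k b+k≡a 1≤k = record
    { sequence = f ▷ sequence
    ; periodic = periodic-↠ (≈-restrict f) periodic
    ; position = position ℕ.∸ s
    ; leading  = leading-▷ 1≤s (ℕ.≤-trans (s≤s z≤n) s<j′) (subst (λ j → Leading j sequence) (≡.sym (ℕ.m+[n∸m]≡n s≤j)) leading)
    ; bound    = ℕ.≤-trans (ℕ.≤-reflexive p^k≡1+s) (ℕ.m≤n⇒m≤1+n s<j′)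
    ; units    = unitsAt
    }
    where
    open Stage (stage b (suc k) (≡.trans (ℕ.+-suc b k) b+k≡a) (s≤s z≤n))
    s = ℕ.pred (p ℕ.^ k)
    f = powerMinusOne s
    p^k≡1+s : p ℕ.^ k ≡ suc s
    p^k≡1+s = ≡.sym (ℕ.suc-pred (p ℕ.^ k) {{Q.p^≢0 impulses k}})
    1≤s : 1 ≤ s
    1≤s = ℕ.s≤s⁻¹ (subst (1 <_) p^k≡1+s (ℕ.<-≤-trans 1<p (subst (_≤ p ℕ.^ k) (ℕ.^-identityʳ p) (ℕ.^-monoʳ-≤ p {{prime⇒nonZero isPrime}} 1≤k))))
    -- As p ≥ 2, the previous bound gives 2 (s + 1) ≤ position + 1; after subtracting s at least s +
    -- 1 = p ^ k remains.
    2s<j : suc (s ℕ.+ s) ≤ position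
    2s<j = ℕ.s≤s⁻¹ (ℕ.≤-trans (ℕ.≤-trans (ℕ.≤-reflexive double) (ℕ.*-monoˡ-≤ (suc s) 1<p))
             (subst (λ P → p ℕ.* P ≤ suc position) p^k≡1+s bound))
      where
      double : suc (suc (s ℕ.+ s)) ≡ 2 ℕ.* suc s
      double = cong suc (≡.trans (≡.sym (ℕ.+-suc s s)) (cong (s ℕ.+_) (≡.sym (ℕ.+-identityʳ (suc s)))))
    s≤j : s ≤ position
    s≤j = ℕ.≤-trans (ℕ.m≤n⇒m≤1+n (ℕ.m≤m+n s s)) 2s<j
    s<j′ : suc s ≤ position ℕ.∸ s
    s<j′ = ℕ.m+n≤o⇒m≤o∸n (suc s) 2s<j
    unitsAt : ∀ {t} → k ≤ t → t < a → Unit (f ▷ sequence) (powerMinusOne (ℕ.pred (p ℕ.^ t)))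
    -- Earlier factors remain units on the new sequence; the factor just applied becomes one.
    unitsAt k≤t t<a with ℕ.m≤n⇒m<n∨m≡n k≤t
    ... | inj₁ k<t    = unit-↠ (≈-restrict f) (units k<t t<a)
    ... | inj₂ ≡.refl = unit-▷ periodic f

  record FieldSequence (w : Sequence) : Set where
    field
      periodic   : Periodic w
      nontrivial : Nontrivial w
      zeroOrUnit : ∀ f → f ≈[ w ] con F.0# ⊎ Unit w f
      units      : ∀ {t} → 1 ≤ t → t < a → Unit w (powerMinusOne (ℕ.pred (p ℕ.^ t)))

  fieldSequence : 1 ≤ a → ∃ FieldSequence
  fieldSequence 1≤a =
    -- Since X ^ n = 1, every polynomial is congruent to some `value n i`, so a finite list
    -- suffices.
    let w , v↠w , nontrivial , all = makeZeroOrUnit (map (value n) (allFin _)) periodic (leading⇒nontrivial leading)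
    in w , record
      { periodic   = periodic-↠ v↠w periodic
      ; nontrivial = nontrivial
      ; zeroOrUnit = λ f → let i , f≈ = code (span-all (span-resp (sym periodic) (span-1 m)) f) in
          [ (λ v≈0 → inj₁ (Q.trans w (v↠w f≈) v≈0))
          , (λ (g , e) → inj₂ (g , Q.trans w (Q.*-congˡ w {g} (v↠w f≈)) e))
          ]′ (All.lookup all (∈-map⁺ (value n) (∈-allFin i)))
      ; units      = λ 1≤t t<a → unit-↠ v↠w (units 1≤t t<a)
      }
    where
    open Stage (stage (a ℕ.∸ 1) 1 (ℕ.m∸n+n≡m 1≤a) ℕ.≤-refl)
    open Q sequence

  -- The dimension of the field over ℤ/p is a.

  module _ {w} (fieldSeq : FieldSequence w) where

    open FieldSequence fieldSeq
    open Q w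
    open MonicPolynomials (Poly/Ann w)
    open import Algebra.Properties.Ring ring using (-1*x≈-x)
    open import Relation.Binary.Reasoning.Setoid setoid

    cancel : ∀ x y z → x * z ≈ y * z → x ≈ y ⊎ z ≈ 0#
    cancel x y z xz≈yz with zeroOrUnit z
    ... | inj₁ z≈0 = inj₂ z≈0
    ... | inj₂ (z⁻¹ , z⁻¹z≈1) = inj₁ (begin
      x              ≈⟨ undo x ⟨
      x * z * z⁻¹    ≈⟨ *-congʳ xz≈yz ⟩
      y * z * z⁻¹    ≈⟨ undo y ⟩
      y              ∎)
      where
      undo : ∀ x → x * z * z⁻¹ ≈ x
      undo x = trans (*-assoc x z z⁻¹) (trans (*-congˡ {x} (trans (*-comm z z⁻¹) z⁻¹z≈1)) (*-identityʳ x))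

    -- `X` has the inverse X ^ m, so X ^ (p ^ t) = X would give X ^ (p ^ t - 1) = 1 and make a unit
    -- zero.
    X^p^t≉X : ∀ {t} → 1 ≤ t → t < a → ¬ X ^ (p ℕ.^ t) ≈ X
    X^p^t≉X {t} 1≤t t<a X^p^t≈X with g , g*≈1 ← units 1≤t t<a = nontrivial (begin
      1#              ≈⟨ g*≈1 ⟨
      g * powerMinusOne s      ≈⟨ *-congˡ {g} factor≈0 ⟩
      g * 0#          ≈⟨ zeroʳ g ⟩
      0#              ∎)
      where
      s = ℕ.pred (p ℕ.^ t)
      X^1+s≈X : X ^ suc s ≈ X
      X^1+s≈X = subst (λ k → X ^ k ≈ X) (≡.sym (ℕ.suc-pred (p ℕ.^ t) {{p^≢0 t}})) X^p^t≈X
      X^s≈1 : X ^ s ≈ 1#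
      X^s≈1 = begin
        X ^ s                ≈⟨ *-identityˡ _ ⟨
        1# * X ^ s           ≈⟨ *-congʳ {X ^ s} periodic ⟨
        X ^ suc m * X ^ s    ≈⟨ *-congʳ {X ^ s} (*-comm X (X ^ m)) ⟩
        X ^ m * X * X ^ s    ≈⟨ *-assoc (X ^ m) X (X ^ s) ⟩
        X ^ m * X ^ suc s    ≈⟨ *-congˡ {X ^ m} X^1+s≈X ⟩
        X ^ m * X            ≈⟨ *-comm (X ^ m) X ⟩
        X ^ suc m            ≈⟨ periodic ⟩
        1#                   ∎
      factor≈0 : powerMinusOne s ≈ 0#
      factor≈0 = begin
        X ^[ impulses ] s + con (F.- F.1#)  ≡⟨ cong (_+ con (F.- F.1#)) (^-independent impulses w X s) ⟩
        X ^ s + con (F.- F.1#)              ≈⟨ +-cong X^s≈1 (sym (*-identityʳ _)) ⟩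
        1# + - 1#                           ≈⟨ -‿inverseʳ 1# ⟩
        0#                                  ∎

    conjugate : Fin a → Poly
    conjugate i = X ^ (p ℕ.^ toℕ i)

    -- Raise an equality of two conjugates to the power p ^ (a - i): one side becomes X ^ q = X, the
    -- other X ^ (p ^ (j - i)).
    conjugates-< : ∀ {i j} → i < j → j < a → ¬ X ^ (p ℕ.^ i) ≈ X ^ (p ℕ.^ j)
    conjugates-< {i} {j} i<j j<a e = X^p^t≉X (ℕ.m<n⇒0<n∸m i<j) (ℕ.≤-<-trans (ℕ.m∸n≤m j i) j<a) (begin
      X ^ (p ℕ.^ (j ℕ.∸ i))                              ≈⟨ fermat periodic _ ⟨
      (X ^ (p ℕ.^ (j ℕ.∸ i))) ^ (p ℕ.^ a)                ≈⟨ raise (X ^ (p ℕ.^ (j ℕ.∸ i))) ⟩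
      ((X ^ (p ℕ.^ (j ℕ.∸ i))) ^ (p ℕ.^ i)) ^ (p ℕ.^ (a ℕ.∸ i)) ≈⟨ ^-congˡ (p ℕ.^ (a ℕ.∸ i)) (trans (^-assocʳ X (p ℕ.^ (j ℕ.∸ i)) (p ℕ.^ i)) (^-congʳ X p^j)) ⟩
      (X ^ (p ℕ.^ j)) ^ (p ℕ.^ (a ℕ.∸ i))                ≈⟨ ^-congˡ (p ℕ.^ (a ℕ.∸ i)) e ⟨
      (X ^ (p ℕ.^ i)) ^ (p ℕ.^ (a ℕ.∸ i))                ≈⟨ raise X ⟨
      X ^ (p ℕ.^ a)                                      ≈⟨ fermat periodic X ⟩
      X                                                  ∎)
      where
      i≤a = ℕ.<⇒≤ (ℕ.<-trans i<j j<a)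
      p^j : p ℕ.^ (j ℕ.∸ i) ℕ.* p ℕ.^ i ≡ p ℕ.^ j
      p^j = ≡.trans (≡.sym (ℕ.^-distribˡ-+-* p (j ℕ.∸ i) i)) (cong (p ℕ.^_) (ℕ.m∸n+n≡m (ℕ.<⇒≤ i<j)))
      raise : ∀ x → x ^ (p ℕ.^ a) ≈ (x ^ (p ℕ.^ i)) ^ (p ℕ.^ (a ℕ.∸ i))
      raise x = trans (^-congʳ x (≡.trans (cong (p ℕ.^_) (≡.sym (ℕ.m+[n∸m]≡n i≤a))) (ℕ.^-distribˡ-+-* p i (a ℕ.∸ i))))
        (sym (^-assocʳ x (p ℕ.^ i) (p ℕ.^ (a ℕ.∸ i))))

    conjugate-injective : Injective _≡_ _≈_ conjugate
    conjugate-injective {i} {j} e with ℕ.<-cmp (toℕ i) (toℕ j)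
    ... | tri< i<j _ _ = contradiction e (conjugates-< i<j (Fin.toℕ<n j))
    ... | tri≈ _ i≡j _ = Fin.toℕ-injective i≡j
    ... | tri> _ _ j<i = contradiction (sym e) (conjugates-< j<i (Fin.toℕ<n i))

    -- A relation for X ^ d is a monic polynomial of degree d that vanishes at `X`, hence at all a
    -- conjugates.
    minimalPolynomial-degree : ∀ {d} → Span d (X ^ d) → a ≤ d
    minimalPolynomial-degree {d} X^d∈span =
      roots-≤-degree nontrivial cancel
        (monic-+evalAt (monic-power d) ℕ.≤-refl relation) conjugate conjugate-injective isRoot
      where
      relation : Span d (con (F.- F.1#) * X ^ d)
      relation = span-con (F.- F.1#) X^d∈span
      isRoot : ∀ i → conjugate i ^ d + evalAt relation (conjugate i) ≈ 0#
      isRoot i = begin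
        conjugate i ^ d + evalAt relation (conjugate i)  ≈⟨ +-cong (^-swap X P d) (sym (evalAt-frobenius (toℕ i) relation X)) ⟩
        (X ^ d) ^ P + evalAt relation X ^ P              ≈⟨ frobenius-+ (toℕ i) _ _ ⟨
        (X ^ d + evalAt relation X) ^ P                  ≈⟨ ^-congˡ P (+-congˡ (evalAt-X relation)) ⟩
        (X ^ d + - (X ^ d)) ^ P                          ≈⟨ ^-congˡ P (-‿inverseʳ (X ^ d)) ⟩
        0# ^ P                                           ≈⟨ 0^ P {{p^≢0 (toℕ i)}} ⟩
        0#                                               ∎
        where P = p ℕ.^ toℕ i

    -- Every element is a root of T ^ q - T, which is monic of degree q because 1 < q.
    distinct-≤ : ∀ {l} (root : Fin l → Poly) → Injective _≡_ _≈_ root → l ≤ p ℕ.^ a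
    distinct-≤ root inj = roots-≤-degree nontrivial cancel
      (monic-addTerm (monic-power (p ℕ.^ a)) 1<q (- 1#)) root inj λ i → begin
        root i ^ (p ℕ.^ a) + - 1# * (root i * 1#)  ≈⟨ +-cong (fermat periodic (root i)) (trans (*-congˡ (*-identityʳ (root i))) (-1*x≈-x (root i))) ⟩
        root i + - root i                          ≈⟨ -‿inverseʳ (root i) ⟩
        0#                                         ∎

    galoisField : FiniteIntegralDomain (p ℕ.^ a)
    galoisField
      with d , _ , X^d∈span , least
        ← leastPositive (λ d → span? periodic d (X ^ d)) {n} (s≤s z≤n) (span-resp (sym periodic) (span-1 m))
      = record
      { ring = Poly/Ann w
      ; cancel = cancel
      ; element = value a
      ; element-injective = subst (λ d → Injective _≡_ _≈_ (value d)) d≡a injective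
      ; code = λ f → proj₁ (codeOf f)
      ; element-code = λ f → proj₂ (codeOf f)
      }
      where
      independent : ∀ {j} → j < d → ¬ Span j (X ^ j)
      -- The minimality of d covers positive exponents only; for exponent 0 a relation would mean 1
      -- = 0.
      independent {zero}  _   (nil e) = nontrivial e
      independent {suc j} j<d s       = contradiction (least (s≤s z≤n) s) (ℕ.<⇒≱ j<d)
      injective : Injective _≡_ _≈_ (value d)
      injective = value-injective d independent
      d≤a : d ≤ a
      d≤a = ℕ.≮⇒≥ λ a<d → ℕ.<⇒≱ (ℕ.^-monoʳ-< p 1<p a<d) (distinct-≤ (value d) injective)
      d≡a : d ≡ a
      d≡a = ℕ.≤-antisym d≤a (minimalPolynomial-degree X^d∈span)
      codeOf : ∀ f → ∃ λ i → f ≈ value a i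
      codeOf f = code (subst (λ d → Span d f) d≡a (span-all X^d∈span f))

-- The integers modulo p.

module Modular (p : ℕ) where

  infix 4 _≈_
  record _≈_ (x y : ℤ) : Set where
    constructor mod
    field difference : + p ℤ.∣ x ℤ.- y

  private
    via : ∀ {x y z} → + p ℤ.∣ z → z ≡ x ℤ.- y → x ≈ y
    via d ≡.refl = mod d

  ≈-reflexive : ∀ {x y} → x ≡ y → x ≈ y
  ≈-reflexive {x} ≡.refl = mod (ℤ.divides ℤ.0ℤ (ℤ.+-inverseʳ x))

  _≈?_ : ∀ x y → Dec (x ≈ y)
  x ≈? y = map′ mod _≈_.difference (+ p ℤ.∣? (x ℤ.- y))

  ring : CommutativeRing 0ℓ 0ℓ
  ring = record
    { Carrier = ℤ
    ; _≈_ = _≈_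
    ; _+_ = ℤ._+_
    ; _*_ = ℤ._*_
    ; -_  = ℤ.-_
    ; 0#  = ℤ.0ℤ
    ; 1#  = ℤ.1ℤ
    ; isCommutativeRing = record
      { isRing = record
        { +-isAbelianGroup = record
          { isGroup = record
            { isMonoid = record
              { isSemigroup = record
                { isMagma = record
                  { isEquivalence = record
                    { refl  = ≈-reflexive ≡.refl
                    ; sym   = λ { {x} {y} (mod d) → via (ℤ.∣m⇒∣-m d) (sym-eq x y) }
                    ; trans = λ { {x} {y} {z} (mod d) (mod e) → via (ℤ.∣m∣n⇒∣m+n d e) (trans-eq x y z) }
                    }
                  ; ∙-cong = λ { {x} {y} {u} {v} (mod d) (mod e) → via (ℤ.∣m∣n⇒∣m+n d e) (+-eq x y u v) }
                  }
                ; assoc = λ x y z → ≈-reflexive (ℤ.+-assoc x y z)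
                }
              ; identity = (λ x → ≈-reflexive (ℤ.+-identityˡ x)) , (λ x → ≈-reflexive (ℤ.+-identityʳ x))
              }
            ; inverse = (λ x → ≈-reflexive (ℤ.+-inverseˡ x)) , (λ x → ≈-reflexive (ℤ.+-inverseʳ x))
            ; ⁻¹-cong = λ { {x} {y} (mod d) → via (ℤ.∣m⇒∣-m d) (neg-eq x y) }
            }
          ; comm = λ x y → ≈-reflexive (ℤ.+-comm x y)
          }
        ; *-cong = λ { {x} {y} {u} {v} (mod d) (mod e) →
            via (ℤ.∣m∣n⇒∣m+n (ℤ.∣m⇒∣m*n u d) (ℤ.∣n⇒∣m*n y e)) (*-eq x y u v) }
        ; *-assoc = λ x y z → ≈-reflexive (ℤ.*-assoc x y z)
        ; *-identity = (λ x → ≈-reflexive (ℤ.*-identityˡ x)) , (λ x → ≈-reflexive (ℤ.*-identityʳ x))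
        ; distrib = (λ x y z → ≈-reflexive (ℤ.*-distribˡ-+ x y z)) , (λ x y z → ≈-reflexive (ℤ.*-distribʳ-+ x y z))
        }
      ; *-comm = λ x y → ≈-reflexive (ℤ.*-comm x y)
      }
    }
    where
    sym-eq : ∀ x y → ℤ.- (x ℤ.- y) ≡ y ℤ.- x
    sym-eq = ℤ.solve-∀
    trans-eq : ∀ x y z → (x ℤ.- y) ℤ.+ (y ℤ.- z) ≡ x ℤ.- z
    trans-eq = ℤ.solve-∀
    +-eq : ∀ x y u v → (x ℤ.- y) ℤ.+ (u ℤ.- v) ≡ (x ℤ.+ u) ℤ.- (y ℤ.+ v)
    +-eq = ℤ.solve-∀
    neg-eq : ∀ x y → ℤ.- (x ℤ.- y) ≡ ℤ.- x ℤ.- ℤ.- y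
    neg-eq = ℤ.solve-∀
    *-eq : ∀ x y u v → (x ℤ.- y) ℤ.* u ℤ.+ y ℤ.* (u ℤ.- v) ≡ x ℤ.* u ℤ.- y ℤ.* v
    *-eq = ℤ.solve-∀

  p≈0 : + p ≈ ℤ.0ℤ
  p≈0 = via ℤ.∣-refl (≡.sym (ℤ.+-identityʳ (+ p)))

  residue : .{{_ : NonZero p}} → ∀ x → x ≈ + (x %ℕ p)
  residue x = via (ℤ.divides (x /ℕ p) ≡.refl)
    (≡.trans (cancel-eq (+ (x %ℕ p)) ((x /ℕ p) ℤ.* + p))
             (cong (ℤ._- + (x %ℕ p)) (≡.sym (a≡a%ℕn+[a/ℕn]*n x p))))
    where
    cancel-eq : ∀ r s → s ≡ (r ℤ.+ s) ℤ.- r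
    cancel-eq = ℤ.solve-∀

  module _ (isPrime : Prime p) where
    open CommutativeRing ring using (trans; *-congˡ)

    1≉0 : ¬ ℤ.1ℤ ≈ ℤ.0ℤ
    1≉0 (mod d) = contradiction (∣⇒≤ (ℤ.∣⇒∣ᵤ d)) (ℕ.<⇒≱ (ℕ.nonTrivial⇒n>1 p))
      where instance _ = prime⇒nonTrivial isPrime

    private
      lift : ∀ x u y v → 1 ℕ.+ y ℕ.* v ≡ x ℕ.* u → ℤ.1ℤ ℤ.+ + y ℤ.* + v ≡ + x ℤ.* + u
      lift x u y v eq = begin
        ℤ.1ℤ ℤ.+ + y ℤ.* + v   ≡⟨ cong (λ z → ℤ.1ℤ ℤ.+ z) (ℤ.pos-* y v) ⟨
        + (1 ℕ.+ y ℕ.* v)      ≡⟨ cong +_ eq ⟩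
        + (x ℕ.* u)            ≡⟨ ℤ.pos-* x u ⟩
        + x ℤ.* + u            ∎
        where open ≡.≡-Reasoning

    -- Bézout over ℕ comes in two signs: 1 + y r = x p makes -y an inverse of r, and 1 + x p = y r
    -- makes y one.
    invertible-ℕ : ∀ r → .{{_ : NonZero r}} → r < p → ∃ λ s → s ℤ.* + r ≈ ℤ.1ℤ
    invertible-ℕ r r<p with coprime-Bézout (prime⇒coprime isPrime r<p)
    ... | Bézout.+- x y eq = ℤ.- + y , via (ℤ.divides (ℤ.- + x) ≡.refl)
      (≡.trans (≡.sym (ℤ.neg-distribˡ-* (+ x) (+ p)))
        (≡.trans (cong ℤ.-_ (≡.sym (lift x p y r eq))) (rearrange (+ y) (+ r))))
      where
      rearrange : ∀ y r → ℤ.- (ℤ.1ℤ ℤ.+ y ℤ.* r) ≡ ℤ.- y ℤ.* r ℤ.- ℤ.1ℤ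
      rearrange = ℤ.solve-∀
    ... | Bézout.-+ x y eq = + y , via (ℤ.divides (+ x) ≡.refl)
      (≡.trans (rearrange (+ x ℤ.* + p)) (cong (ℤ._- ℤ.1ℤ) (lift y r x p eq)))
      where
      rearrange : ∀ z → z ≡ (ℤ.1ℤ ℤ.+ z) ℤ.- ℤ.1ℤ
      rearrange = ℤ.solve-∀

    invertible : ∀ x → ¬ x ≈ ℤ.0ℤ → ∃ λ s → s ℤ.* x ≈ ℤ.1ℤ
    invertible x x≉0 =
      let s , sr≈1 = invertible-ℕ (x %ℕ p) {{r≢0}} (n%ℕd<d x p)
      in s , trans (*-congˡ {s} (residue x)) sr≈1
      where
      instance _ = prime⇒nonZero isPrime
      r≢0 : NonZero (x %ℕ p)
      r≢0 = ℕ.≢-nonZero λ r≡0 → x≉0 (trans (residue x) (≈-reflexive (cong +_ r≡0)))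

  open import Algebra.Definitions.RawMonoid (CommutativeRing.+-rawMonoid ring) using () renaming (_×_ to _·_)

  n·1≡n : ∀ n → n · ℤ.1ℤ ≡ + n
  n·1≡n zero    = ≡.refl
  n·1≡n (suc n) = cong (λ z → ℤ.1ℤ ℤ.+ z) (n·1≡n n)

  numeral-surjective : .{{_ : NonZero p}} → ∀ x → ∃ λ (i : Fin p) → x ≈ toℕ i · ℤ.1ℤ
  numeral-surjective x = i , trans (residue x) (≈-reflexive (≡.sym (≡.trans (n·1≡n (toℕ i)) (cong +_ (Fin.toℕ-fromℕ< _)))))
    where
    open CommutativeRing ring using (trans)
    i = fromℕ< (n%ℕd<d x p)

  private
    -- The difference m - n is divisible by p but smaller than p, so it is zero.
    ≤-case : ∀ {m n} → m < p → n ≤ m → m · ℤ.1ℤ ≈ n · ℤ.1ℤ → m ≡ n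
    ≤-case {m} {n} m<p n≤m (mod d) with m ℕ.∸ n in eq
    ... | zero  = ℕ.≤-antisym (ℕ.m∸n≡0⇒m≤n eq) n≤m
    ... | suc k = contradiction (∣⇒≤ {{_}} p∣) (ℕ.<⇒≱ (ℕ.≤-<-trans (subst (_≤ m) eq (ℕ.m∸n≤m m n)) m<p))
      where
      p∣ : p ∣ suc k
      p∣ = subst (λ z → p ∣ ℤ.∣ z ∣)
        (≡.trans (cong₂ ℤ._-_ (n·1≡n m) (n·1≡n n)) (≡.trans (ℤ.m-n≡m⊖n m n) (≡.trans (ℤ.⊖-≥ n≤m) (cong +_ eq))))
        (ℤ.∣⇒∣ᵤ d)

  numeral-injective : ∀ {i j : Fin p} → toℕ i · ℤ.1ℤ ≈ toℕ j · ℤ.1ℤ → i ≡ j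
  numeral-injective {i} {j} i≈j with ℕ.≤-total (toℕ i) (toℕ j)
  ... | inj₁ i≤j = ≡.sym (Fin.toℕ-injective (≤-case (Fin.toℕ<n j) i≤j (sym i≈j)))
    where open CommutativeRing ring using (sym)
  ... | inj₂ j≤i = Fin.toℕ-injective (≤-case (Fin.toℕ<n i) j≤i i≈j)

-- The colouring of points against lines.

module IncidenceColouring {q} (K : FiniteIntegralDomain q) where

  open FiniteIntegralDomain K
  open import Algebra.Properties.Group +-group using (∙-cancelˡ; ∙-cancelʳ; x∙y⁻¹≈ε⇒x≈y)
  open import Algebra.Solver.Ring.NaturalCoefficients.Default commutativeSemiring
  open import Relation.Binary.Reasoning.Setoid setoid

  -- The two base-q digits of a vertex: (x , y) for a point on the left, (m , b) for a line on the
  -- right.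
  fst snd : Fin (q ℕ.^ 2) → Carrier
  fst v = element (finToFun {q} {2} v zero)
  snd v = element (finToFun {q} {2} v (suc zero))

  coordinates-injective : ∀ {v v′} → fst v ≈ fst v′ → snd v ≈ snd v′ → v ≡ v′
  coordinates-injective {v} {v′} e e′ =
    ≡.trans (≡.sym (Fin.funToFin-finToFin {2} {q} v))
      (≡.trans (cong₂ (λ i j → combine i (combine j zero)) (element-injective e) (element-injective e′))
        (Fin.funToFin-finToFin {2} {q} v′))

  height : Fin (q ℕ.^ 2) → Fin (q ℕ.^ 2) → Carrier
  height u v = snd u + (snd v + fst v * fst u)

  colouring : Colouring q (q ℕ.^ 2)
  colouring u v = code (height u v)

  same-colour : ∀ {u v u′ v′} → colouring u v ≡ colouring u′ v′ → height u v ≈ height u′ v′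
  same-colour {u} {v} {u′} {v′} e = trans (element-code (height u v))
    (trans (reflexive (cong element e)) (sym (element-code (height u′ v′))))

  -- The hypothesis is (m - m′)(x - x′) = 0 with the negative terms moved across.
  rectangle : ∀ m m′ x x′ → m * x + m′ * x′ ≈ m′ * x + m * x′ → m ≈ m′ ⊎ x ≈ x′
  rectangle m m′ x x′ e with cancel m m′ (x + - x′) m[x-x′]≈m′[x-x′]
    where
    m[x-x′]≈m′[x-x′] : m * (x + - x′) ≈ m′ * (x + - x′)
    m[x-x′]≈m′[x-x′] = ∙-cancelʳ (m * x′ + m′ * x′) _ _ (begin
      -- The solver works over semirings, so -x′ enters as an independent variable, cancelled
      -- afterwards by `vanish`.
      m * (x + - x′) + (m * x′ + m′ * x′)  ≈⟨ solve 5 (λ m m′ x x′ y → m :* (x :+ y) :+ (m :* x′ :+ m′ :* x′) := (m :* x :+ m′ :* x′) :+ m :* (x′ :+ y)) refl m m′ x x′ (- x′) ⟩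
      (m * x + m′ * x′) + m * (x′ + - x′)  ≈⟨ +-cong e (trans (vanish m) (sym (vanish m′))) ⟩
      (m′ * x + m * x′) + m′ * (x′ + - x′) ≈⟨ solve 5 (λ m m′ x x′ y → (m′ :* x :+ m :* x′) :+ m′ :* (x′ :+ y) := m′ :* (x :+ y) :+ (m :* x′ :+ m′ :* x′)) refl m m′ x x′ (- x′) ⟩
      m′ * (x + - x′) + (m * x′ + m′ * x′) ∎)
      where
      vanish : ∀ m → m * (x′ + - x′) ≈ 0#
      vanish m = trans (*-congˡ (-‿inverseʳ x′)) (zeroʳ m)
  ... | inj₁ m≈m′ = inj₁ m≈m′
  ... | inj₂ x-x′≈0 = inj₂ (x∙y⁻¹≈ε⇒x≈y x x′ x-x′≈0)

  -- The four colours force equal slopes or equal abscissas. Equal slopes make the lines coincide,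
  -- by their agreement over `u`; equal abscissas make the points coincide, by their equal colours
  -- along `v`.
  noMonochromaticC₄ : ¬ HasMonochromaticC₄ colouring
  noMonochromaticC₄ (_ , u , u′ , v , v′ , u≢u′ , v≢v′ , uv , uv′ , u′v , u′v′) =
    [ v≢v′ ∘ v≡v′ , u≢u′ ∘ u≡u′ ]′ (rectangle (fst v) (fst v′) (fst u) (fst u′) crossed)
    where
    line : ∀ {w} → colouring w v ≡ colouring w v′ → snd v + fst v * fst w ≈ snd v′ + fst v′ * fst w
    line {w} e = ∙-cancelˡ (snd w) _ _ (same-colour e)
    onu : snd v + fst v * fst u ≈ snd v′ + fst v′ * fst u
    onu = line (≡.trans uv (≡.sym uv′))
    onu′ : snd v + fst v * fst u′ ≈ snd v′ + fst v′ * fst u′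
    onu′ = line (≡.trans u′v (≡.sym u′v′))
    -- Adding the equation at `u` to the reversed equation at `u′` puts the same intercepts on both
    -- sides.
    crossed : fst v * fst u + fst v′ * fst u′ ≈ fst v′ * fst u + fst v * fst u′
    crossed = ∙-cancelˡ (snd v + snd v′) _ _ (begin
      snd v + snd v′ + (fst v * fst u + fst v′ * fst u′)     ≈⟨ interchange _ _ _ _ ⟩
      (snd v + fst v * fst u) + (snd v′ + fst v′ * fst u′)   ≈⟨ +-cong onu (sym onu′) ⟩
      (snd v′ + fst v′ * fst u) + (snd v + fst v * fst u′)   ≈⟨ interchange _ _ _ _ ⟩
      snd v′ + snd v + (fst v′ * fst u + fst v * fst u′)     ≈⟨ +-congʳ (+-comm _ _) ⟩
      snd v + snd v′ + (fst v′ * fst u + fst v * fst u′)     ∎)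
      where open import Algebra.Properties.CommutativeSemigroup +-commutativeSemigroup using (interchange)
    v≡v′ : fst v ≈ fst v′ → v ≡ v′
    v≡v′ m≈m′ = coordinates-injective m≈m′
      (∙-cancelʳ (fst v * fst u) _ _ (trans onu (+-congˡ (*-congʳ (sym m≈m′)))))
    u≡u′ : fst u ≈ fst u′ → u ≡ u′
    u≡u′ x≈x′ = coordinates-injective x≈x′
      (∙-cancelʳ (snd v + fst v * fst u) _ _
        (trans (same-colour (≡.trans uv (≡.sym u′v))) (+-congˡ (+-congˡ (*-congˡ (sym x≈x′))))))

-- Restriction to smaller graphs, and the lower bound.

restrict : ∀ {k b b′} → b ≤ b′ → Colouring k b′ → Colouring k b
restrict b≤b′ c x y = c (inject≤ x b≤b′) (inject≤ y b≤b′)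

restrict-C₄ : ∀ {k b b′} (b≤b′ : b ≤ b′) {c : Colouring k b′} →
              HasMonochromaticC₄ (restrict b≤b′ c) → HasMonochromaticC₄ c
restrict-C₄ b≤b′ (i , x , x′ , y , y′ , x≢x′ , y≢y′ , edges) =
  i , _ , _ , _ , _ ,
  x≢x′ ∘ Fin.inject≤-injective b≤b′ b≤b′ x x′ , y≢y′ ∘ Fin.inject≤-injective b≤b′ b≤b′ y y′ , edges

primeField : ∀ {p} → Prime p → PrimeField p
primeField {p} isPrime = record
  { isPrime           = isPrime
  ; ring              = ring
  ; _≈?_              = _≈?_
  ; 1≉0               = 1≉0 isPrime
  ; p·1≈0             = CommutativeRing.trans ring (≈-reflexive (n·1≡n p)) p≈0
  ; numeral           = numeral-surjective {{prime⇒nonZero isPrime}}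
  ; numeral-injective = numeral-injective
  ; invertible        = invertible isPrime
  }
  where open Modular p

galoisFieldOfOrder : ∀ {p} a → Prime p → 1 ≤ a → FiniteIntegralDomain (p ℕ.^ a)
galoisFieldOfOrder {p} a isPrime 1≤a = galoisField (proj₂ (fieldSequence 1≤a))
  where
  instance _ = prime⇒nonTrivial isPrime
  2≤q : 2 ≤ p ℕ.^ a
  2≤q = ℕ.≤-trans (ℕ.nonTrivial⇒n>1 p)
    (subst (_≤ p ℕ.^ a) (ℕ.^-identityʳ p) (ℕ.^-monoʳ-≤ p {{prime⇒nonZero isPrime}} 1≤a))
  open GaloisField (primeField isPrime) a (p ℕ.^ a ℕ.∸ 2) (≡.sym (ℕ.m+[n∸m]≡n 2≤q))

open import Data.Nat using (_+_; _^_; _≥_)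

theorem7 : (k : ℕ) → PrimePower k → b₂ k ≥ k ^ 2 + 1
theorem7 k (p , a , isPrime , 1≤a , ≡.refl) =
  -- Were `b₂ k` at most k ^ 2, the restricted colouring would have a monochromatic cycle, which is
  -- also one of the full colouring.
  subst (_≤ b₂ k) (ℕ.+-comm 1 (k ℕ.^ 2)) (ℕ.≰⇒> λ b₂≤k² →
    noMonochromaticC₄ (restrict-C₄ b₂≤k² {c = colouring} (arrows (restrict b₂≤k² colouring))))
  where
  open IncidenceColouring (galoisFieldOfOrder a isPrime 1≤a)
  open IsBipartiteRamseyNumber (b₂-isBipartiteRamseyNumber k)
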